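{- For all integers $k \ge 4$ and $n \ge (k-1)(k-2)$ such that $n$ is divisible by $k-1$, we have \[ f_k(n) \le (4k-10)\,2^{\frac{n}{k-1}} - 7(k-2). \]
   Context: Let $[n] = \{1,2,\ldots,n\}$. For integers $n,k \ge 2$, a family $\mathcal{F}$ of subsets of $[n]$ is called $k$-wise intersecting if every (non-empty) collection of at most $k$ members of $\mathcal{F}$ has a non-empty intersection. A family $\mathcal{F}$ of subsets of $[n]$ is called maximal $k$-wise intersecting if it is $k$-wise intersecting and adding to $\mathcal{F}$ any subset of $[n]$ not already in $\mathcal{F}$ yields a family that is not $k$-wise intersecting. Let $f_k(n)$ denote the minimum possible size (number of members) of a maximal $k$-wise intersecting family of subsets of $[n]$. -}

module Defs where

open import Data.Fin.Subset using (Subset; Nonempty; ⋂)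
open import Data.List using (List; []; _∷_; length)
open import Data.List.Membership.Propositional using (_∉_)
open import Data.List.Relation.Binary.Subset.Propositional using (_⊆_)
open import Data.List.Relation.Unary.Unique.Propositional using (Unique)
open import Data.Nat using (ℕ; _≤_)
open import Data.Product using (_×_; ∃-syntax)
open import Relation.Binary.PropositionalEquality using (_≡_; _≢_)
open import Relation.Nullary using (¬_)

-- The ground set [n] is Fin n.  A family of subsets of [n] is the list of its
-- members; its cardinality is the length of that list once the list is
-- required to be duplicate-free, as in SizeOfMaximal below.
Family : ℕ → Set
Family n = List (Subset n)

-- The subcollection G may repeat members: lists of length at most k drawn
-- from F enumerate exactly the collections of at most k members of F, and
-- ⋂ ignores repetitions.
KWiseIntersecting : ∀ {n} → ℕ → Family n → Set
KWiseIntersecting {n} k F =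
  (G : List (Subset n)) → G ≢ [] → length G ≤ k → G ⊆ F → Nonempty (⋂ G)

MaximalKWiseIntersecting : ∀ {n} → ℕ → Family n → Set
MaximalKWiseIntersecting {n} k F =
  KWiseIntersecting k F ×
  ((A : Subset n) → A ∉ F → ¬ KWiseIntersecting k (A ∷ F))

SizeOfMaximal : (k n m : ℕ) → Set
SizeOfMaximal k n m =
  ∃[ F ] Unique F × MaximalKWiseIntersecting {n} k F × length F ≡ m

-- IsMinimumSize k n m says that the minimum f_k(n) exists and equals m.
IsMinimumSize : (k n m : ℕ) → Set
IsMinimumSize k n m = SizeOfMaximal k n m × (∀ m′ → SizeOfMaximal k n m′ → m ≤ m′)

{-# OPTIONS --safe #-}
-- Pass to complements: a k-wise intersecting family becomes one no k of whose members cover the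
-- ground set.  Write k = 4 + w and split the ground set into 3 + w parts A, B, C, D₀, …, D_{w-1} of size m.
-- There is such a family (the "generators") to which few sets S can be added: the complement of S is
-- covered by k - 1 generators for all but at most (4k - 10) 2^m - 7(k - 2) sets S.  Every
-- maximal k-wise intersecting family extending the complements of the generators is then that small.
--
-- With special points β₀, …, β_w in each part, o = β₀, the generators are
--   A∖x, with o ∈ C added if x ≠ o;        C∖x, with o ∈ B added if x ≠ o;
--   B∖x, with o ∈ A added if x is not special;  B∖{βᵢ, βⱼ} for i ≠ j, with o ∈ A added;
--   D_t;                                   D_t∖x, with β_{t+1} ∈ B and o ∈ C added.
-- A cover by k generators uses at least one per part, so at most one part is used twice; what a
-- part used once misses must be supplied by other parts, and no part used twice supplies enough.
-- On the other hand, when S has non-special points in two parts, generators missing these points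
-- supply all the other parts, so a set that can be added is a subset of one part together with at
-- most two special points of other parts.
module Submission where

open import Defs
import Algebra.Properties.CommutativeSemigroup as CommSemigroupₚ
open import Data.Bool using (not)
open import Data.Bool.Properties using (not-involutive) renaming (_≟_ to _≟ᵇ_)
import Data.Empty as Empty
open import Data.Empty using (⊥-elim)
open import Data.Fin using (Fin; zero; suc; combine; remQuot; splitAt; _↑ˡ_; _↑ʳ_)
import Data.Fin.Properties as Finₚ
open import Data.Fin.Subset as Sub using (Subset; Nonempty; ⋂; ⊤; ⊥; ⁅_⁆; ∁)
import Data.Fin.Subset.Properties as Subₚ
open import Data.Integer as ℤ using (+_)
import Data.Integer.Properties as ℤₚ
import Data.Integer.Tactic.RingSolver as ℤ-Solver
open import Data.List using (List; []; _∷_; _++_; length; map; filter; deduplicate; concatMap;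
  allFin; tabulate; cartesianProduct)
import Data.List.Properties as Listₚ
open import Data.List.Membership.Propositional using (_∈_; _∉_; find; lose)
import Data.List.Membership.Propositional.Properties as Memₚ
import Data.List.Membership.DecPropositional as DecMem
open import Data.List.Relation.Binary.Subset.Propositional using (_⊆_)
open import Data.List.Relation.Unary.All as All using (All; []; _∷_; all?)
import Data.List.Relation.Unary.All.Properties as Allₚ
open import Data.List.Relation.Unary.AllPairs using ([]; _∷_)
open import Data.List.Relation.Unary.Any as Any using (here; there)
open import Data.List.Relation.Unary.Unique.Propositional using (Unique)
import Data.List.Relation.Unary.Unique.Propositional.Properties as Uniqueₚ
import Data.List.Relation.Unary.Unique.DecPropositional as DecUnique
import Data.List.Relation.Unary.Unique.DecPropositional.Properties as DecUniqueₚ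
open import Data.Nat using (ℕ; zero; suc; _+_; _*_; _∸_; _^_; _≤_; z≤n; s≤s)
open import Data.Nat.Divisibility using (_∣_; quotient; divides)
open import Data.Nat.ListAction using (sum)
import Data.Nat.Properties as ℕₚ
open import Data.Nat.Tactic.RingSolver using (solve-∀)
open import Data.Product using (∃-syntax; ∃₂; _×_; _,_; proj₁; proj₂; uncurry; swap)
import Data.Product.Properties as Productₚ
open import Data.Sum using (_⊎_; inj₁; inj₂)
import Data.Sum.Properties as Sumₚ
open import Data.Vec as Vec using ([]; _∷_)
import Data.Vec.Properties as Vecₚ
open import Data.Vec.Functional using (updateAt)
open import Data.Vec.Functional.Properties using (updateAt-updates; updateAt-minimal)
open import Function using (_∘_; case_of_)
open import Level using (Level)
open import Relation.Binary.Definitions using (DecidableEquality)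
open import Relation.Binary.PropositionalEquality
open import Relation.Nullary using (¬_; Dec; yes; no; ¬?)
open import Relation.Nullary.Decidable using (_×-dec_; _⊎-dec_; map′; does;
  decidable-stable; dec-true; dec-false)
open import Relation.Unary using (Decidable)

private variable
  a p : Level
  X : Set a
  n : ℕ

_≟ˢ_ : DecidableEquality (Subset n)
_≟ˢ_ = Vecₚ.≡-dec _≟ᵇ_

-- Finite families and their saturation

unique-⊆-length : {xs ys : List X} → Unique xs → xs ⊆ ys → length xs ≤ length ys
unique-⊆-length [] _ = z≤n
unique-⊆-length {xs = x ∷ xs} (x≢ ∷ u) xs⊆ys
  with Memₚ.∈-∃++ (xs⊆ys (here refl))
... | as , bs , refl = ℕₚ.≤-trans (s≤s (unique-⊆-length u xs⊆as++bs)) (ℕₚ.≤-reflexive (sym len))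
  where
  len : length (as ++ x ∷ bs) ≡ suc (length (as ++ bs))
  len = Listₚ.length-++-sucʳ as x bs
  xs⊆as++bs : xs ⊆ as ++ bs
  xs⊆as++bs z∈xs with Memₚ.∈-++⁻ as (xs⊆ys (there z∈xs))
  ... | inj₁ z∈as = Memₚ.∈-++⁺ˡ z∈as
  ... | inj₂ (here refl) = ⊥-elim (All.lookup x≢ z∈xs refl)
  ... | inj₂ (there z∈bs) = Memₚ.∈-++⁺ʳ as z∈bs

module _ {X : Set a} (_≟_ : DecidableEquality X) where

  without : List X → List X → List X
  without []       ys = ys
  without (e ∷ es) ys = filter (λ y → ¬? (y ≟ e)) (without es ys)

  ∈-without : ∀ {es ys x} → x ∈ ys → x ∉ es → x ∈ without es ys
  ∈-without {[]}     x∈ys x∉es = x∈ys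
  ∈-without {e ∷ es} x∈ys x∉es =
    Memₚ.∈-filter⁺ _ (∈-without x∈ys (x∉es ∘ there)) (x∉es ∘ here)

  -- The filters for `es` act first and, as `e` is not in `es`, leave `e` in place; so the filter
  -- for `e` deletes at least one entry.
  length-without : ∀ {es ys} → Unique es → es ⊆ ys → length (without es ys) + length es ≤ length ys
  length-without [] _ = ℕₚ.≤-reflexive (ℕₚ.+-identityʳ _)
  length-without {e ∷ es} {ys} (e≢ ∷ u) es⊆ys = begin
    length (without (e ∷ es) ys) + suc (length es) ≡⟨ ℕₚ.+-suc _ _ ⟩
    suc (length (without (e ∷ es) ys)) + length es ≤⟨ ℕₚ.+-monoˡ-≤ _ (Listₚ.filter-notAll _ _ e∈) ⟩
    length (without es ys) + length es             ≤⟨ length-without u (es⊆ys ∘ there) ⟩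
    length ys                                      ∎
    where
    open ℕₚ.≤-Reasoning
    e∈ = Any.map (λ e≡y y≢e → y≢e (sym e≡y))
           (∈-without (es⊆ys (here refl)) (λ e∈es → All.lookup e≢ e∈es refl))

subsets : ∀ n → List (Subset n)
subsets zero    = [] ∷ []
subsets (suc n) = map (Sub.inside ∷_) (subsets n) ++ map (Sub.outside ∷_) (subsets n)

∈-subsets : (S : Subset n) → S ∈ subsets n
∈-subsets []                = here refl
∈-subsets (Sub.inside ∷ S)  = Memₚ.∈-++⁺ˡ (Memₚ.∈-map⁺ _ (∈-subsets S))
∈-subsets (Sub.outside ∷ S) = Memₚ.∈-++⁺ʳ _ (Memₚ.∈-map⁺ _ (∈-subsets S))

length-subsets : ∀ n → length (subsets n) ≡ 2 ^ n
length-subsets zero    = refl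
length-subsets (suc n) = begin
  length (subsets (suc n))
    ≡⟨ Listₚ.length-++ (map (Sub.inside ∷_) (subsets n)) ⟩
  length (map (Sub.inside ∷_) (subsets n)) + length (map (Sub.outside ∷_) (subsets n))
    ≡⟨ cong₂ _+_ (Listₚ.length-map _ (subsets n)) (Listₚ.length-map _ (subsets n)) ⟩
  length (subsets n) + length (subsets n)
    ≡⟨ cong₂ _+_ (length-subsets n) (trans (length-subsets n) (sym (ℕₚ.+-identityʳ _))) ⟩
  2 ^ suc n ∎
  where open ≡-Reasoning

-- Intersections of lists of subsets, and decidability of maximality

∈-⋂⁺ : (G : List (Subset n)) {x : Fin n} → (∀ {U} → U ∈ G → x Sub.∈ U) → x Sub.∈ ⋂ G
∈-⋂⁺ []      _ = Subₚ.∈⊤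
∈-⋂⁺ (U ∷ G) h = Subₚ.x∈p∩q⁺ (h (here refl) , ∈-⋂⁺ G (h ∘ there))

∈-⋂⁻ : (G : List (Subset n)) {x : Fin n} → x Sub.∈ ⋂ G → ∀ {U} → U ∈ G → x Sub.∈ U
∈-⋂⁻ (U ∷ G) x∈ (here refl) = proj₁ (Subₚ.x∈p∩q⁻ U (⋂ G) x∈)
∈-⋂⁻ (U ∷ G) x∈ (there V∈)  = ∈-⋂⁻ G (proj₂ (Subₚ.x∈p∩q⁻ U (⋂ G) x∈)) V∈

-- The empty list is included so that the quantifier can be peeled off one entry at a time;
-- `kWiseIntersecting?` allows for it through the disjunct `G ≡ []`.
BoundedLists : ℕ → (List X → Set p) → List X → Set _
BoundedLists k P F = ∀ G → length G ≤ k → G ⊆ F → P G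

boundedLists? : ∀ k {P : List X → Set p} → Decidable P → ∀ F → Dec (BoundedLists k P F)
boundedLists? zero    P? F = map′ (λ { p [] _ _ → p }) (λ h → h [] z≤n λ ()) (P? [])
boundedLists? (suc k) {P} P? F =
  map′ to from (P? [] ×-dec all? (λ x → boundedLists? k (P? ∘ (x ∷_)) F) F)
  where
  to : P [] × All (λ x → BoundedLists k (P ∘ (x ∷_)) F) F → BoundedLists (suc k) P F
  to (p , h) []      _       _ = p
  to (p , h) (x ∷ G) (s≤s l) s = All.lookup h (s (here refl)) G l (s ∘ there)
  from : BoundedLists (suc k) P F → P [] × All (λ x → BoundedLists k (P ∘ (x ∷_)) F) F
  from h = h [] z≤n (λ ()) , All.tabulate from-∷
    where
    from-∷ : ∀ {x} → x ∈ F → BoundedLists k (P ∘ (x ∷_)) F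
    from-∷ x∈F G l s = h (_ ∷ G) (s≤s l) λ { (here refl) → x∈F ; (there i) → s i }

kWiseIntersecting? : ∀ k → Decidable (KWiseIntersecting {n} k)
kWiseIntersecting? k F =
  map′ (λ h G ne l s → case h G l s of λ { (inj₁ refl) → ⊥-elim (ne refl) ; (inj₂ x) → x })
       (λ { h [] _ _ → inj₁ refl ; h (U ∷ G) l s → inj₂ (h (U ∷ G) (λ ()) l s) })
       (boundedLists? k {P = λ G → G ≡ [] ⊎ Nonempty (⋂ G)}
         (λ G → Listₚ.≡-dec _≟ˢ_ G [] ⊎-dec Subₚ.nonempty? (⋂ G)) F)

maximalKWiseIntersecting? : ∀ k → Decidable (MaximalKWiseIntersecting {n} k)
maximalKWiseIntersecting? k F =
  kWiseIntersecting? k F ×-dec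
  map′ (λ h A A∉F kw → h (A , A∉F , kw)) (λ { h (A , A∉F , kw) → h A A∉F kw })
    (¬? (Subₚ.anySubset? λ A → ¬? (A ∈? F) ×-dec kWiseIntersecting? k (A ∷ F)))
  where open DecMem _≟ˢ_ using (_∈?_)

anyListOfLength? : ∀ m {P : List (Subset n) → Set} → Decidable P → Dec (∃[ F ] length F ≡ m × P F)
anyListOfLength? zero    P? = map′ (λ p → [] , refl , p) (λ { ([] , _ , p) → p }) (P? [])
anyListOfLength? (suc m) P? =
  map′ (λ { (A , F , l , p) → A ∷ F , cong suc l , p })
       (λ { (A ∷ F , l , p) → A , F , ℕₚ.suc-injective l , p })
       (Subₚ.anySubset? λ A → anyListOfLength? m (P? ∘ (A ∷_)))

sizeOfMaximal? : ∀ k n → Decidable (SizeOfMaximal k n)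
sizeOfMaximal? k n m =
  map′ (λ { (F , l , u , x) → F , u , x , l }) (λ { (F , u , x , l) → F , l , u , x })
    (anyListOfLength? m λ F → unique? F ×-dec maximalKWiseIntersecting? k F)
  where open DecUnique _≟ˢ_ using (unique?)

-- Existence of the minimum size and its bound by saturation

least : {P : ℕ → Set p} → Decidable P → ∀ {m} → P m → ∃[ l ] P l × (∀ l′ → P l′ → l ≤ l′)
least P? {zero}  pm = zero , pm , λ _ _ → z≤n
least P? {suc m} pm with P? zero
... | yes p0 = zero , p0 , λ _ _ → z≤n
... | no ¬p0 with least (P? ∘ suc) pm
...   | l , pl , min = suc l , pl , λ { zero p → ⊥-elim (¬p0 p) ; (suc l′) p → s≤s (min l′ p) }

kWiseIntersecting-⊆ : ∀ {k} {F F′ : Family n} → F ⊆ F′ → KWiseIntersecting k F′ → KWiseIntersecting k F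
kWiseIntersecting-⊆ F⊆F′ kw G ne l s = kw G ne l (F⊆F′ ∘ s)

module _ {n k : ℕ} where
  open DecMem (_≟ˢ_ {n}) using (_∈?_)

  -- One greedy pass over `As` suffices: a set rejected at some stage stays rejected for every
  -- larger family, since subfamilies of k-wise intersecting families are k-wise intersecting.
  saturate : (As F : Family n) → Unique F → KWiseIntersecting k F →
    ∃[ F′ ] F ⊆ F′ × Unique F′ × KWiseIntersecting k F′ ×
      (∀ {A} → A ∈ As → A ∉ F′ → ¬ KWiseIntersecting k (A ∷ F′))
  saturate [] F u kw = F , (λ x → x) , u , kw , λ ()
  saturate (A ∷ As) F u kw with A ∈? F | kWiseIntersecting? k (A ∷ F)
  ... | no A∉F | yes kwA =
    let F′ , A∷F⊆F′ , u′ , kw′ , max = saturate As (A ∷ F) (Allₚ.¬Any⇒All¬ _ A∉F ∷ u) kwA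
    in F′ , A∷F⊆F′ ∘ there , u′ , kw′ ,
       λ { (here refl) A∉F′ _ → A∉F′ (A∷F⊆F′ (here refl)) ; (there B∈As) → max B∈As }
  ... | yes A∈F | _ =
    let F′ , F⊆F′ , u′ , kw′ , max = saturate As F u kw
    in F′ , F⊆F′ , u′ , kw′ ,
       λ { (here refl) A∉F′ _ → A∉F′ (F⊆F′ A∈F) ; (there B∈As) → max B∈As }
  ... | no _ | no ¬kwA =
    let F′ , F⊆F′ , u′ , kw′ , max = saturate As F u kw
    in F′ , F⊆F′ , u′ , kw′ ,
       λ { (here refl) _ kwA′ → ¬kwA (kWiseIntersecting-⊆
             (λ { (here refl) → here refl ; (there i) → there (F⊆F′ i) }) kwA′)
         ; (there B∈As) → max B∈As }

  -- Saturating `F` over all subsets gives a maximal family, so the minimum exists. That family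
  -- extends `F`, hence lies in `L` and, being duplicate-free, is no longer than `L`.
  minimumSize≤ : (F L : Family n) → KWiseIntersecting k F →
    (∀ {F′} → F ⊆ F′ → KWiseIntersecting k F′ → F′ ⊆ L) →
    ∃[ m ] IsMinimumSize k n m × m ≤ length L
  minimumSize≤ F L kw bound =
    let F₀ = deduplicate _≟ˢ_ F
        F⊆F₀ = Memₚ.∈-deduplicate⁺ _≟ˢ_
        F′ , F₀⊆F′ , u , kw′ , max = saturate (subsets n) F₀ (DecUniqueₚ.deduplicate-! _≟ˢ_ F)
          (kWiseIntersecting-⊆ (Memₚ.∈-deduplicate⁻ _≟ˢ_ F) kw)
        size = F′ , u , (kw′ , λ A → max (∈-subsets A)) , refl
        m , sm , min = least (sizeOfMaximal? k n) size
    in m , (sm , min) ,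
       ℕₚ.≤-trans (min _ size) (unique-⊆-length u (bound (F₀⊆F′ ∘ F⊆F₀) kw′))

⟦_⟧ : ∀ {n p} {P : Fin n → Set p} → (∀ i → Dec (P i)) → Subset n
⟦ P? ⟧ = Vec.tabulate (does ∘ P?)

∈-⟦⟧⁺ : ∀ {n p} {P : Fin n → Set p} (P? : ∀ i → Dec (P i)) {i} → P i → i Sub.∈ ⟦ P? ⟧
∈-⟦⟧⁺ P? {i} pi = Vecₚ.lookup⇒[]= i _ (trans (Vecₚ.lookup∘tabulate (does ∘ P?) i) (dec-true (P? i) pi))

∈-⟦⟧⁻ : ∀ {n p} {P : Fin n → Set p} (P? : ∀ i → Dec (P i)) {i} → i Sub.∈ ⟦ P? ⟧ → P i
∈-⟦⟧⁻ P? {i} i∈ = decidable-stable (P? i) λ ¬pi →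
  case trans (sym (dec-false (P? i) ¬pi))
         (trans (sym (Vecₚ.lookup∘tabulate (does ∘ P?) i)) (Vecₚ.[]=⇒lookup i∈)) of λ ()

_⊎ᴸ_ : ∀ {X Y : Set} → List X → List Y → List (X ⊎ Y)
xs ⊎ᴸ ys = map inj₁ xs ++ map inj₂ ys

∈-⊎ᴸ : ∀ {X Y : Set} {xs : List X} {ys : List Y} →
  (∀ x → x ∈ xs) → (∀ y → y ∈ ys) → ∀ z → z ∈ xs ⊎ᴸ ys
∈-⊎ᴸ all-xs all-ys (inj₁ x) = Memₚ.∈-++⁺ˡ (Memₚ.∈-map⁺ inj₁ (all-xs x))
∈-⊎ᴸ all-xs all-ys (inj₂ y) = Memₚ.∈-++⁺ʳ _ (Memₚ.∈-map⁺ inj₂ (all-ys y))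

-- The generators

module Construction {m w : ℕ} (β : Fin (suc w) → Fin m) (β-injective : ∀ {i j} → β i ≡ β j → i ≡ j)
                    (ν : Fin m) (ν-generic : ∀ j → β j ≢ ν) where

  Part : Set
  Part = Fin (3 + w)

  pattern A   = zero
  pattern B   = suc zero
  pattern C   = suc (suc zero)
  pattern D t = suc (suc (suc t))

  Point : Set
  Point = Part × Fin m

  o : Fin m
  o = β zero

  ν≢o : ν ≢ o
  ν≢o = ν-generic zero ∘ sym

  Generic : Fin m → Set
  Generic x = ∀ j → β j ≢ x

  special? : ∀ x → (∃[ j ] β j ≡ x) ⊎ Generic x
  special? x with Finₚ.any? (λ j → β j Finₚ.≟ x)
  ... | yes s = inj₁ s
  ... | no ¬s = inj₂ λ j e → ¬s (j , e)

  generic? : ∀ x → Dec (Generic x)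
  generic? x = Finₚ.all? λ j → ¬? (β j Finₚ.≟ x)

  -- Codes for the generators. `B∖∖ i i` covers the same points as `B∖ (β i)`, since `B⇒A` asks for
  -- distinct indices.
  Gen : Set
  Gen = Fin m ⊎ Fin m ⊎ (Fin (suc w) × Fin (suc w)) ⊎ Fin m ⊎ Fin w ⊎ (Fin w × Fin m)

  pattern A∖ x     = inj₁ x
  pattern B∖ x     = inj₂ (inj₁ x)
  pattern B∖∖ i j  = inj₂ (inj₂ (inj₁ (i , j)))
  pattern C∖ x     = inj₂ (inj₂ (inj₂ (inj₁ x)))
  pattern D∖∅ t    = inj₂ (inj₂ (inj₂ (inj₂ (inj₁ t))))
  pattern D∖ t x   = inj₂ (inj₂ (inj₂ (inj₂ (inj₂ (t , x)))))

  _≟ᵍ_ : DecidableEquality Gen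
  _≟ᵍ_ = Sumₚ.≡-dec Finₚ._≟_ (Sumₚ.≡-dec Finₚ._≟_ (Sumₚ.≡-dec (Productₚ.≡-dec Finₚ._≟_ Finₚ._≟_)
           (Sumₚ.≡-dec Finₚ._≟_ (Sumₚ.≡-dec Finₚ._≟_ (Productₚ.≡-dec Finₚ._≟_ Finₚ._≟_)))))

  part : Gen → Part
  part (A∖ _)    = A
  part (B∖ _)    = B
  part (B∖∖ _ _) = B
  part (C∖ _)    = C
  part (D∖∅ t)   = D t
  part (D∖ t _)  = D t

  missed : Gen → List (Fin m)
  missed (A∖ x)    = x ∷ []
  missed (B∖ x)    = x ∷ []
  missed (B∖∖ i j) = β i ∷ β j ∷ []
  missed (C∖ x)    = x ∷ []
  missed (D∖∅ _)   = []
  missed (D∖ _ x)  = x ∷ []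

  -- The points that a generator contains outside its own part. The index for `D t` is shifted by
  -- one because `β zero` is `o`, which C supplies to B.
  data Helps : Gen → Part → Fin m → Set where
    A→C : ∀ {x} → x ≢ o → Helps (A∖ x) C o
    B→A : ∀ {x} → Generic x → Helps (B∖ x) A o
    B⇒A : ∀ {i j} → i ≢ j → Helps (B∖∖ i j) A o
    C→B : ∀ {x} → x ≢ o → Helps (C∖ x) B o
    D→B : ∀ {t x} → Helps (D∖ t x) B (β (suc t))
    D→C : ∀ {t x} → Helps (D∖ t x) C o

  helps? : ∀ g p x → Dec (Helps g p x)
  helps? (A∖ x) A y = no λ ()
  helps? (A∖ x) B y = no λ ()
  helps? (A∖ x) C y = map′ (λ { (x≢o , refl) → A→C x≢o }) (λ { (A→C x≢o) → x≢o , refl })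
                           (¬? (x Finₚ.≟ o) ×-dec (y Finₚ.≟ o))
  helps? (A∖ x) (D t) y = no λ ()
  helps? (B∖ x) A y = map′ (λ { (g , refl) → B→A g }) (λ { (B→A g) → g , refl })
                           (generic? x ×-dec (y Finₚ.≟ o))
  helps? (B∖ x) (suc p) y = no λ ()
  helps? (B∖∖ i j) A y = map′ (λ { (i≢j , refl) → B⇒A i≢j }) (λ { (B⇒A i≢j) → i≢j , refl })
                           (¬? (i Finₚ.≟ j) ×-dec (y Finₚ.≟ o))
  helps? (B∖∖ i j) (suc p) y = no λ ()
  helps? (C∖ x) A y = no λ ()
  helps? (C∖ x) B y = map′ (λ { (x≢o , refl) → C→B x≢o }) (λ { (C→B x≢o) → x≢o , refl })
                           (¬? (x Finₚ.≟ o) ×-dec (y Finₚ.≟ o))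
  helps? (C∖ x) (suc (suc p)) y = no λ ()
  helps? (D∖∅ t) p y = no λ ()
  helps? (D∖ t x) A y = no λ ()
  helps? (D∖ t x) B y = map′ (λ { refl → D→B }) (λ { D→B → refl }) (y Finₚ.≟ β (suc t))
  helps? (D∖ t x) C y = map′ (λ { refl → D→C }) (λ { D→C → refl }) (y Finₚ.≟ o)
  helps? (D∖ t x) (D _) y = no λ ()

  Covers : Gen → Part → Fin m → Set
  Covers g p x = (part g ≡ p × x ∉ missed g) ⊎ Helps g p x

  covers? : ∀ g p x → Dec (Covers g p x)
  covers? g p x = ((part g Finₚ.≟ p) ×-dec ¬? (DecMem._∈?_ Finₚ._≟_ x (missed g))) ⊎-dec helps? g p x

  -- No k generators cover the ground set

  module NoCover (G : List Gen) (G-short : length G ≤ 4 + w)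
                 (cover : ∀ p x → ∃[ g ] g ∈ G × Covers g p x) where

    -- Points supplied from other parts are special, so `ν` is reached only from its own part, and
    -- nothing is supplied to `D t`. Hence a cover uses every part.
    unhelped : ∀ p → ∃[ x ] (∀ g → ¬ Helps g p x)
    unhelped A = ν , λ { _ (B→A _) → ν≢o refl ; _ (B⇒A _) → ν≢o refl }
    unhelped B = ν , λ { _ (C→B _) → ν≢o refl ; _ D→B → ν-generic _ refl }
    unhelped C = ν , λ { _ (A→C _) → ν≢o refl ; _ D→C → ν≢o refl }
    unhelped (D t) = o , λ { _ () }

    representative : ∀ p → ∃[ g ] g ∈ G × part g ≡ p
    representative p with unhelped p
    ... | x , ¬help with cover p x
    ...   | g , g∈G , inj₁ (pg , _) = g , g∈G , pg
    ...   | g , g∈G , inj₂ h        = ⊥-elim (¬help g h)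

    ρ : Part → Gen
    ρ p = proj₁ (representative p)

    ρ∈G : ∀ p → ρ p ∈ G
    ρ∈G p = proj₁ (proj₂ (representative p))

    part-ρ : ∀ p → part (ρ p) ≡ p
    part-ρ p = proj₂ (proj₂ (representative p))

    Extra : Part → Set
    Extra p = ∃[ g ] g ∈ G × part g ≡ p × g ≢ ρ p

    -- Representatives of the 3 + w parts and extras of two different parts would be 5 + w distinct
    -- members of `G`.
    extra-unique : ∀ {p q} → Extra p → Extra q → p ≡ q
    extra-unique {p} {q} (g , g∈G , pg , g≢) (h , h∈G , ph , h≢) with p Finₚ.≟ q
    ... | yes p≡q = p≡q
    ... | no  p≢q = ⊥-elim (ℕₚ.1+n≰n (ℕₚ.≤-trans (subst (λ l → 2 + l ≤ length G) length-reps
                                        (unique-⊆-length distinct ⊆G)) G-short))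
      where
      reps = map ρ (allFin (3 + w))
      fresh : ∀ {g p} → part g ≡ p → g ≢ ρ p → All (g ≢_) reps
      fresh {g} pg g≢ = Allₚ.map⁺ (All.universal (λ r g≡ρr →
        g≢ (trans g≡ρr (cong ρ (trans (sym (part-ρ r)) (trans (cong part (sym g≡ρr)) pg))))) _)
      distinct : Unique (g ∷ h ∷ reps)
      distinct = ((λ { refl → p≢q (trans (sym pg) ph) }) ∷ fresh pg g≢) ∷ fresh ph h≢ ∷
        Uniqueₚ.map⁺ (λ {r} {s} e → trans (sym (part-ρ r)) (trans (cong part e) (part-ρ s)))
                     (Uniqueₚ.allFin⁺ (3 + w))
      ⊆G : g ∷ h ∷ reps ⊆ G
      ⊆G (here refl)         = g∈G
      ⊆G (there (here refl)) = h∈G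
      ⊆G (there (there i)) with Memₚ.∈-map⁻ ρ i
      ... | r , _ , refl = ρ∈G r
      length-reps : length reps ≡ 3 + w
      length-reps = trans (Listₚ.length-map ρ (allFin (3 + w))) (Listₚ.length-tabulate {n = 3 + w} (λ p → p))

    -- If another generator of the same part covers `x`, it differs from `g`, so at least one of the
    -- two is not the chosen representative.
    missed-covered : ∀ {g x} → g ∈ G → x ∈ missed g →
      Extra (part g) ⊎ ∃[ h ] h ∈ G × Helps h (part g) x
    missed-covered {g} {x} g∈G x∈ with cover (part g) x
    ... | h , h∈G , inj₂ help = inj₂ (h , h∈G , help)
    ... | h , h∈G , inj₁ (ph , x∉) with h ≟ᵍ ρ (part g)
    ...   | no  h≢ρ = inj₁ (h , h∈G , ph , h≢ρ)
    ...   | yes h≡ρ = inj₁ (g , g∈G , refl , λ g≡ρ → x∉ (subst (λ f → x ∈ missed f) (trans g≡ρ (sym h≡ρ)) x∈))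

    -- By extra-unique, the two missed points of B∖∖ i j cannot be supplied by two different parts.
    helper-extra : ∀ {h p x} → h ∈ G → Helps h p x → Extra (part h)
    helper-extra h∈G (A→C x≢o) with missed-covered h∈G (here refl)
    ... | inj₁ e                       = e
    ... | inj₂ (_ , _ , B→A _)         = ⊥-elim (x≢o refl)
    ... | inj₂ (_ , _ , B⇒A _)         = ⊥-elim (x≢o refl)
    helper-extra h∈G (B→A x-generic) with missed-covered h∈G (here refl)
    ... | inj₁ e                       = e
    ... | inj₂ (_ , _ , C→B _)         = ⊥-elim (x-generic zero refl)
    ... | inj₂ (_ , _ , D→B)           = ⊥-elim (x-generic _ refl)
    helper-extra h∈G (C→B x≢o) with missed-covered h∈G (here refl)
    ... | inj₁ e                       = e
    ... | inj₂ (_ , _ , A→C _)         = ⊥-elim (x≢o refl)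
    ... | inj₂ (_ , _ , D→C)           = ⊥-elim (x≢o refl)
    helper-extra h∈G D→B with missed-covered h∈G (here refl)
    ... | inj₁ e = e
    helper-extra h∈G D→C with missed-covered h∈G (here refl)
    ... | inj₁ e = e
    helper-extra {B∖∖ i j} h∈G (B⇒A i≢j) with supplier (here refl) | supplier (there (here refl))
      where
      supplier : ∀ {l} → β l ∈ missed (B∖∖ i j) →
        Extra B ⊎ (Extra C × l ≡ zero) ⊎ ∃[ t ] Extra (D t) × l ≡ suc t
      -- The point `β l` is generalised to a variable with an equation; comparing it with the point
      -- supplied then determines `l` by `β-injective`.
      supplier {l} l∈ = analyse refl (missed-covered h∈G l∈)
        where
        analyse : ∀ {x} → β l ≡ x → Extra B ⊎ (∃[ h ] h ∈ G × Helps h B x) →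
          Extra B ⊎ (Extra C × l ≡ zero) ⊎ ∃[ t ] Extra (D t) × l ≡ suc t
        analyse e (inj₁ x) = inj₁ x
        analyse e (inj₂ (_ , h∈G , h@(C→B _))) = inj₂ (inj₁ (helper-extra h∈G h , β-injective e))
        analyse e (inj₂ (_ , h∈G , h@D→B))     = inj₂ (inj₂ (_ , helper-extra h∈G h , β-injective e))
    ... | inj₁ e | _ = e
    ... | inj₂ _ | inj₁ e = e
    ... | inj₂ (inj₁ (_ , i≡0)) | inj₂ (inj₁ (_ , j≡0)) = ⊥-elim (i≢j (trans i≡0 (sym j≡0)))
    ... | inj₂ (inj₁ (e , _)) | inj₂ (inj₂ (_ , f , _)) = case extra-unique e f of λ ()
    ... | inj₂ (inj₂ (_ , f , _)) | inj₂ (inj₁ (e , _)) = case extra-unique e f of λ ()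
    ... | inj₂ (inj₂ (_ , e , refl)) | inj₂ (inj₂ (_ , f , refl)) with extra-unique e f
    ...   | refl = ⊥-elim (i≢j refl)

    misses : ∀ g → (∀ t → part g ≢ D t) → ∃[ x ] x ∈ missed g
    misses (A∖ x)    _  = x , here refl
    misses (B∖ x)    _  = x , here refl
    misses (B∖∖ i j) _  = β i , here refl
    misses (C∖ x)    _  = x , here refl
    misses (D∖∅ t)   ≢D = ⊥-elim (≢D t refl)
    misses (D∖ t x)  _  = x , here refl

    -- No generator of A, B or C covers its whole part, so the representative leaves a point to an
    -- extra or to a helper, and a helper's part has an extra by `helper-extra`.
    source : ∀ p → (∀ t → p ≢ D t) → Extra p ⊎ ∃₂ λ h x → Helps h p x × Extra (part h)
    source p ≢D with misses (ρ p) (λ t e → ≢D t (trans (sym (part-ρ p)) e))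
    ... | x , x∈ with missed-covered (ρ∈G p) x∈
    ...   | inj₁ e             = inj₁ (subst Extra (part-ρ p) e)
    ...   | inj₂ (h , h∈G , i) = inj₂ (h , x , subst (λ q → Helps h q x) (part-ρ p) i , helper-extra h∈G i)

    extra-A⇒⊥ : Extra A → Empty.⊥
    extra-A⇒⊥ a with source B (λ _ ())
    ... | inj₁ b                   = case extra-unique a b of λ ()
    ... | inj₂ (_ , _ , C→B _ , e) = case extra-unique a e of λ ()
    ... | inj₂ (_ , _ , D→B , e)   = case extra-unique a e of λ ()

    extra-B⇒⊥ : Extra B → Empty.⊥
    extra-B⇒⊥ b with source C (λ _ ())
    ... | inj₁ c                   = case extra-unique b c of λ ()
    ... | inj₂ (_ , _ , A→C _ , e) = case extra-unique b e of λ ()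
    ... | inj₂ (_ , _ , D→C , e)   = case extra-unique b e of λ ()

    -- The part used twice is A or supplies A, and only B supplies A. But A supplies nothing to B,
    -- and B nothing to C, so in either case some part stays uncovered.
    impossible : Empty.⊥
    impossible with source A (λ _ ())
    ... | inj₁ a                   = extra-A⇒⊥ a
    ... | inj₂ (_ , _ , B→A _ , e) = extra-B⇒⊥ e
    ... | inj₂ (_ , _ , B⇒A _ , e) = extra-B⇒⊥ e

  -- The generators as subsets of the ground set

  infix 4 _∈ᴾ_
  -- The index within the part comes first in `combine`, giving size `m * (3 + w)`, the form in
  -- which divisibility by k - 1 presents n.
  _∈ᴾ_ : Point → Subset (m * (3 + w)) → Set
  (p , x) ∈ᴾ S = combine x p Sub.∈ S

  point : Fin (m * (3 + w)) → Point
  point i = swap (remQuot (3 + w) i)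

  point-combine : ∀ x p → point (combine x p) ≡ (p , x)
  point-combine x p = cong swap (Finₚ.remQuot-combine x p)

  combine-point : ∀ i → uncurry (λ p x → combine x p) (point i) ≡ i
  combine-point i = Finₚ.combine-remQuot {m} (3 + w) i

  uncovered? : ∀ g i → Dec (¬ uncurry (Covers g) (point i))
  uncovered? g i = ¬? (uncurry (covers? g) (point i))

  complement : Gen → Subset (m * (3 + w))
  complement g = ⟦ uncovered? g ⟧

  ∈-complement⁺ : ∀ {g p x} → ¬ Covers g p x → (p , x) ∈ᴾ complement g
  ∈-complement⁺ {g} {p} {x} ¬c =
    ∈-⟦⟧⁺ (uncovered? g) (¬c ∘ subst (uncurry (Covers g)) (point-combine x p))

  ∈-complement⁻ : ∀ {g p x} → (p , x) ∈ᴾ complement g → ¬ Covers g p x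
  ∈-complement⁻ {g} {p} {x} i c =
    ∈-⟦⟧⁻ (uncovered? g) i (subst (uncurry (Covers g)) (sym (point-combine x p)) c)

  gens : List Gen
  gens = allFin m ⊎ᴸ (allFin m ⊎ᴸ (cartesianProduct (allFin (suc w)) (allFin (suc w)) ⊎ᴸ
    (allFin m ⊎ᴸ (allFin w ⊎ᴸ cartesianProduct (allFin w) (allFin m)))))

  ∈-gens : ∀ g → g ∈ gens
  ∈-gens = ∈-⊎ᴸ Memₚ.∈-allFin (∈-⊎ᴸ Memₚ.∈-allFin
    (∈-⊎ᴸ (λ (i , j) → Memₚ.∈-cartesianProduct⁺ (Memₚ.∈-allFin i) (Memₚ.∈-allFin j))
    (∈-⊎ᴸ Memₚ.∈-allFin (∈-⊎ᴸ Memₚ.∈-allFin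
      (λ (t , x) → Memₚ.∈-cartesianProduct⁺ (Memₚ.∈-allFin t) (Memₚ.∈-allFin x))))))

  family : Family (m * (3 + w))
  family = map complement gens

  ⊆-family : ∀ G → G ⊆ family → ∃[ gs ] G ≡ map complement gs
  ⊆-family []      _ = [] , refl
  ⊆-family (U ∷ G) s with Memₚ.∈-map⁻ complement (s (here refl)) | ⊆-family G (s ∘ there)
  ... | g , _ , refl | gs , refl = g ∷ gs , refl

  -- An empty intersection of complements would be a cover by at most k generators.
  family-intersecting : KWiseIntersecting (4 + w) family
  family-intersecting G _ short s with ⊆-family G s
  ... | gs , refl with Subₚ.nonempty? (⋂ (map complement gs))
  ...   | yes i = i
  ...   | no ¬i = ⊥-elim (NoCover.impossible gs (subst (_≤ 4 + w) (Listₚ.length-map complement gs) short) cover)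
    where
    cover : ∀ p x → ∃[ g ] g ∈ gs × Covers g p x
    cover p x with Any.any? (λ g → covers? g p x) gs
    ... | yes c = find c
    ... | no ¬c = ⊥-elim (¬i (combine x p , ∈-⋂⁺ _ λ U∈ → case Memₚ.∈-map⁻ complement U∈ of λ
          { (g , g∈ , refl) → ∈-complement⁺ λ c → ¬c (lose g∈ c) }))

  -- Sets that can be added to the generators

  section : Subset (m * (3 + w)) → Part → Subset m
  section S p = ⟦ (λ x → combine x p Subₚ.∈? S) ⟧

  ∈-section⁺ : ∀ {S p x} → (p , x) ∈ᴾ S → x Sub.∈ section S p
  ∈-section⁺ {S} {p} = ∈-⟦⟧⁺ (λ x → combine x p Subₚ.∈? S)

  ∈-section⁻ : ∀ {S p x} → x Sub.∈ section S p → (p , x) ∈ᴾ S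
  ∈-section⁻ {S} {p} = ∈-⟦⟧⁻ (λ x → combine x p Subₚ.∈? S)

  -- (p , X , E) stands for the sets T ∪ X with T an arbitrary subset of part p outside the list E.
  Piece : Set
  Piece = Part × List Point × List (Subset m)

  excluded : Piece → List (Subset m)
  excluded (_ , _ , E) = E

  Placed : Part → List Point → Subset m → Point → Set
  Placed p X T (q , x) = (q ≡ p × x Sub.∈ T) ⊎ (q , x) ∈ X

  placed? : ∀ p X T y → Dec (Placed p X T y)
  placed? p X T (q , x) = ((q Finₚ.≟ p) ×-dec (x Subₚ.∈? T)) ⊎-dec
                          DecMem._∈?_ (Productₚ.≡-dec Finₚ._≟_ Finₚ._≟_) (q , x) X

  place : Part → List Point → Subset m → Subset (m * (3 + w))
  place p X T = ⟦ placed? p X T ∘ point ⟧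

  Fits : Subset (m * (3 + w)) → Piece → Set
  Fits S (p , X , E) =
    section S p ∉ E × All (_∈ᴾ S) X × (∀ q x → (q , x) ∈ᴾ S → q ≢ p → (q , x) ∈ X)

  members : Piece → List (Subset (m * (3 + w)))
  members (p , X , E) = map (place p X) (without _≟ˢ_ E (subsets m))

  ∈-members : ∀ {S} P → Fits S P → S ∈ members P
  ∈-members {S} (p , X , E) (T∉ , X⊆S , only) =
    subst (_∈ members (p , X , E)) (sym (Subₚ.⊆-antisym ⊆₁ ⊆₂))
      (Memₚ.∈-map⁺ (place p X) (∈-without _≟ˢ_ (∈-subsets (section S p)) T∉))
    where
    T = section S p
    ⊆₁ : S Sub.⊆ place p X T
    ⊆₁ {i} i∈S = ∈-⟦⟧⁺ (placed? p X T ∘ point) (shape (point i) (subst (Sub._∈ S) (sym (combine-point i)) i∈S))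
      where
      shape : ∀ y → y ∈ᴾ S → Placed p X T y
      shape (q , x) y∈S with q Finₚ.≟ p
      ... | yes refl = inj₁ (refl , ∈-section⁺ y∈S)
      ... | no  q≢p  = inj₂ (only q x y∈S q≢p)
    ⊆₂ : place p X T Sub.⊆ S
    ⊆₂ {i} i∈ = subst (Sub._∈ S) (combine-point i) (shape (point i) (∈-⟦⟧⁻ (placed? p X T ∘ point) i∈))
      where
      shape : ∀ y → Placed p X T y → y ∈ᴾ S
      shape (q , x) (inj₁ (refl , x∈)) = ∈-section⁻ x∈
      shape y       (inj₂ y∈X)         = All.lookup X⊆S y∈X

  length-members : ∀ p X {E} → Unique E →
    length (members (p , X , E)) + length E ≤ 2 ^ m
  length-members p X {E} u = begin
    length (members (p , X , E)) + length E
      ≡⟨ cong (_+ length E) (Listₚ.length-map (place p X) (without _≟ˢ_ E (subsets m))) ⟩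
    length (without _≟ˢ_ E (subsets m)) + length E
      ≤⟨ length-without _≟ˢ_ u (λ {T} _ → ∈-subsets T) ⟩
    length (subsets m)
      ≡⟨ length-subsets m ⟩
    2 ^ m ∎
    where open ℕₚ.≤-Reasoning

  -- The excluded T give sets that cannot be added to the generators or that lie in another piece too;
  -- their number is what produces the term 7(k - 2).
  corePieces : List Piece
  corePieces =
    (A , []          , ⊤ ∷ ⁅ o ⁆ ∷ []) ∷
    (A , (C , o) ∷ [] , ⊤ ∷ ∁ ⁅ o ⁆ ∷ []) ∷
    (B , []          , ⊤ ∷ ⁅ o ⁆ ∷ ⊥ ∷ []) ∷
    (B , (A , o) ∷ [] , ⊤ ∷ map (λ j → ∁ ⁅ β j ⁆) (allFin (suc w))) ∷
    (C , []          , ⊤ ∷ ⁅ o ⁆ ∷ ⊥ ∷ []) ∷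
    (C , (B , o) ∷ [] , ⊤ ∷ ∁ ⁅ o ⁆ ∷ []) ∷ []

  -- The first piece allows T = `⊤`, as `D∖∅ t` is itself a generator. The last allows T = `⊥`, as
  -- the pair of `β (suc t)` in B and `o` in C lies in no other piece.
  D-pieces : Fin w → List Piece
  D-pieces t =
    (D t , []                              , ⊥ ∷ []) ∷
    (D t , (B , β (suc t)) ∷ []            , ⊤ ∷ ⊥ ∷ []) ∷
    (D t , (C , o) ∷ []                    , ⊤ ∷ ⊥ ∷ []) ∷
    (D t , (B , β (suc t)) ∷ (C , o) ∷ []  , ⊤ ∷ []) ∷ []

  pieces : List Piece
  pieces = corePieces ++ concatMap D-pieces (allFin w)

  -- σ p need not be a generator of part p: if S contains a whole part, its slot is spent on another part.
  module Classification (S : Subset (m * (3 + w)))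
    (uncovered : (σ : Part → Gen) → ¬ (∀ q x → (q , x) ∈ᴾ S ⊎ ∃[ p ] Covers (σ p) q x)) where

    In : Part → Fin m → Set
    In p x = (p , x) ∈ᴾ S

    in? : ∀ p x → Dec (In p x)
    in? p x = combine x p Subₚ.∈? S

    OK : (Part → Gen) → Part → Fin m → Set
    OK σ q x = In q x ⊎ ∃[ p ] Covers (σ p) q x

    choose : Gen → Gen → Gen → (Fin w → Gen) → Part → Gen
    choose a b c d A     = a
    choose a b c d B     = b
    choose a b c d C     = c
    choose a b c d (D t) = d t

    own : ∀ {σ} p {g y} → σ p ≡ g → (y ∈ missed g → OK σ (part g) y) → OK σ (part g) y
    own p {g} {y} refl rest with DecMem._∈?_ Finₚ._≟_ y (missed g)
    ... | yes y∈ = rest y∈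
    ... | no  y∉ = inj₂ (p , inj₁ (refl , y∉))

    help : ∀ {σ} p {g q y} → σ p ≡ g → Helps g q y → OK σ q y
    help p refl h = inj₂ (p , inj₂ h)

    refute : ∀ a b c d → let σ = choose a b c d in
      (∀ y → OK σ A y) → (∀ y → OK σ B y) → (∀ y → OK σ C y) → (∀ t y → OK σ (D t) y) → Empty.⊥
    refute a b c d okA okB okC okD = uncovered (choose a b c d)
      λ { A → okA ; B → okB ; C → okC ; (D t) → okD t }

    only : ∀ {σ q x y} → OK σ q x → y ∈ x ∷ [] → OK σ q y
    only ok (here refl) = ok

    both : ∀ {σ q x x′ y} → OK σ q x → OK σ q x′ → y ∈ x ∷ x′ ∷ [] → OK σ q y
    both ok ok′ (here refl)         = ok
    both ok ok′ (there (here refl)) = ok′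

    whole : Fin w → Gen
    whole = D∖∅

    whole-ok : ∀ {a b c} t y → OK (choose a b c whole) (D t) y
    whole-ok t y = own (D t) refl λ ()

    _[_]≔_ : (Fin w → Gen) → Fin w → Gen → Fin w → Gen
    d [ t ]≔ g = updateAt d t (λ _ → g)

    updated : ∀ d t g → (d [ t ]≔ g) t ≡ g
    updated d t g = updateAt-updates t d

    not-updated : ∀ d {s t} g → s ≢ t → (d [ t ]≔ g) s ≡ d s
    not-updated d {s} {t} g s≢t = updateAt-minimal s t d s≢t

    ν-misses-o : ∀ {σ q y} → o ∈ ν ∷ [] → OK σ q y
    ν-misses-o (here e) = ⊥-elim (ν≢o (sym e))

    -- If S contains A, the slot of A goes to `C∖ ν`, which supplies `o` to B and completes `C∖ o`.
    -- The next two proofs repeat this with the free slot given to `A∖ ν` and to `B∖ ν`.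
    A-not-full : ¬ (∀ x → In A x)
    A-not-full full = refute (C∖ ν) (B∖ o) (C∖ o) whole
      (λ y → inj₁ (full y))
      (λ y → own B refl (only (help A refl (C→B ν≢o))))
      (λ y → own C refl (only (own A refl (ν-misses-o))))
      whole-ok

    B-not-full : ¬ (∀ x → In B x)
    B-not-full full = refute (A∖ o) (A∖ ν) (C∖ o) whole
      (λ y → own A refl (only (own B refl ν-misses-o)))
      (λ y → inj₁ (full y))
      (λ y → own C refl (only (help B refl (A→C ν≢o))))
      whole-ok

    C-not-full : ¬ (∀ x → In C x)
    C-not-full full = refute (A∖ o) (B∖ o) (B∖ ν) whole
      (λ y → own A refl (only (help C refl (B→A ν-generic))))
      (λ y → own B refl (only (own C refl ν-misses-o)))
      (λ y → inj₁ (full y))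
      whole-ok

    -- Sets with a point in some `D t`

    module MeetsD {t x} (x∈D : In (D t) x) where

      -- Since S contains `x`, `D∖ t x` can stand in for `D∖∅ t`, supplying `β (suc t)` to B and `o`
      -- to C.
      d : Fin w → Gen
      d = whole [ t ]≔ D∖ t x

      d-ok : ∀ {a b c} s y → OK (choose a b c d) (D s) y
      d-ok s y with s Finₚ.≟ t
      ... | yes refl = own (D t) (updated whole t _) (only (inj₁ x∈D))
      ... | no  s≢t  = own (D s) (not-updated whole _ s≢t) λ ()

      b-ok : ∀ {a b c} → OK (choose a b c d) B (β (suc t))
      b-ok = help (D t) (updated whole t _) D→B

      c-ok : ∀ {a b c} → OK (choose a b c d) C o
      c-ok = help (D t) (updated whole t _) D→C

      A-empty : ∀ y → ¬ In A y
      A-empty y y∈ = refute (A∖ y) (B∖ (β (suc t))) (C∖ o) d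
        (λ _ → own A refl (only (inj₁ y∈)))
        (λ _ → own B refl (only b-ok))
        (λ _ → own C refl (only c-ok))
        d-ok

      -- Any other point of B in S lets B supply `o` to A: by `B∖ y` if `y` is generic, and
      -- otherwise by `B∖∖ (suc t) j`, whose other missed point comes from `D t`.
      B-special : ∀ y → In B y → y ≡ β (suc t)
      B-special y y∈ with special? y
      ... | inj₂ generic = ⊥-elim (refute (A∖ o) (B∖ y) (C∖ o) d
        (λ _ → own A refl (only (help B refl (B→A generic))))
        (λ _ → own B refl (only (inj₁ y∈)))
        (λ _ → own C refl (only c-ok))
        d-ok)
      ... | inj₁ (j , refl) with suc t Finₚ.≟ j
      ...   | yes refl = refl
      ...   | no  t≢j  = ⊥-elim (refute (A∖ o) (B∖∖ (suc t) j) (C∖ o) d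
        (λ _ → own A refl (only (help B refl (B⇒A t≢j))))
        (λ _ → own B refl (both b-ok (inj₁ y∈)))
        (λ _ → own C refl (only c-ok))
        d-ok)

      -- For `z` other than `o`, `C∖ z` supplies `o` to B; with `β (suc t)` from `D t`, this makes
      -- up for both points missed by a generator that supplies A.
      C-special : ∀ z → In C z → z ≡ o
      C-special z z∈ = decidable-stable (z Finₚ.≟ o) λ z≢o →
        refute (A∖ o) (B∖∖ (suc t) zero) (C∖ z) d
        (λ _ → own A refl (only (help B refl (B⇒A λ ()))))
        (λ _ → own B refl (both b-ok (help C refl (C→B z≢o))))
        (λ _ → own C refl (only (inj₁ z∈)))
        d-ok

      -- Two different parts `D t` and `D s` supply both points missed by `B∖∖ (suc t) (suc s)`,
      -- which in turn supplies A.
      D-only : ∀ s y → In (D s) y → s ≡ t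
      D-only s y y∈ = decidable-stable (s Finₚ.≟ t) λ s≢t →
        let e : Fin w → Gen
            e = d [ s ]≔ D∖ s y
            eₜ = trans (not-updated d (D∖ s y) (s≢t ∘ sym)) (updated whole t (D∖ t x))
        in refute (A∖ o) (B∖∖ (suc t) (suc s)) (C∖ o) e
        (λ _ → own A refl (only (help B refl (B⇒A λ { refl → s≢t refl }))))
        (λ _ → own B refl (both (help (D t) eₜ D→B) (help (D s) (updated d s _) D→B)))
        (λ _ → own C refl (only (help (D t) eₜ D→C)))
        (λ r z → case r Finₚ.≟ s of λ
          { (yes refl) → own (D r) (updated d s _) (only (inj₁ y∈))
          ; (no r≢s)   → case r Finₚ.≟ t of λ
              { (yes refl) → own (D t) eₜ (only (inj₁ x∈D))
              ; (no r≢t)   → own (D r) (trans (not-updated d _ r≢s) (not-updated whole _ r≢t)) λ () } })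

      module _ (full : ∀ y → In (D t) y) where

        full-ok : ∀ {a b c} g s y → OK (choose a b c (whole [ t ]≔ g)) (D s) y
        full-ok g s y with s Finₚ.≟ t
        ... | yes refl = inj₁ (full y)
        ... | no  s≢t  = own (D s) (not-updated whole g s≢t) λ ()

        -- The slot of `D t` is free: `A∖ ν` completes `A∖ o` and supplies `o` to C. In `full⇒¬C`,
        -- `B∖ ν` completes `B∖ o` and supplies `o` to A.
        full⇒¬B : ¬ In B (β (suc t))
        full⇒¬B b∈ = refute (A∖ o) (B∖ (β (suc t))) (C∖ o) (whole [ t ]≔ A∖ ν)
          (λ _ → own A refl (only (own (D t) (updated whole t _) ν-misses-o)))
          (λ _ → own B refl (only (inj₁ b∈)))
          (λ _ → own C refl (only (help (D t) (updated whole t _) (A→C ν≢o))))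
          (full-ok _)

        full⇒¬C : ¬ In C o
        full⇒¬C c∈ = refute (A∖ o) (B∖ o) (C∖ o) (whole [ t ]≔ B∖ ν)
          (λ _ → own A refl (only (help (D t) (updated whole t _) (B→A ν-generic))))
          (λ _ → own B refl (only (own (D t) (updated whole t _) ν-misses-o)))
          (λ _ → own C refl (only (inj₁ c∈)))
          (full-ok _)

    nonempty-section : ∀ {p x} → In p x → section S p ≢ ⊥
    nonempty-section i e = Subₚ.∉⊥ (subst (_ Sub.∈_) e (∈-section⁺ i))

    full-section : ∀ {p} → section S p ≡ ⊤ → ∀ x → In p x
    full-section e x = ∈-section⁻ (subst (x Sub.∈_) (sym e) Subₚ.∈⊤)

    not-full-section : ∀ {p x} → ¬ In p x → section S p ≢ ⊤
    not-full-section ¬i e = ¬i (full-section e _)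

    singleton-section : ∀ {p x} → section S p ≡ ⁅ x ⁆ → In p x × (∀ y → In p y → y ≡ x)
    singleton-section {p} {x} e =
      ∈-section⁻ (subst (x Sub.∈_) (sym e) (Subₚ.x∈⁅x⁆ x)) ,
      λ y i → Subₚ.x∈⁅y⁆⇒x≡y x (subst (y Sub.∈_) e (∈-section⁺ i))

    cosingleton-section : ∀ {p x} → section S p ≡ ∁ ⁅ x ⁆ → ∀ y → y ≢ x → In p y
    cosingleton-section {p} {x} e y y≢x =
      ∈-section⁻ (subst (y Sub.∈_) (sym e) (Subₚ.x∉p⇒x∈∁p (Subₚ.x≢y⇒x∉⁅y⁆ y≢x)))

    ∉[] : ∀ {T : Subset m} → T ∉ []
    ∉[] ()

    ∉∷ : ∀ {T U : Subset m} {Ts} → T ≢ U → T ∉ Ts → T ∉ U ∷ Ts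
    ∉∷ T≢U T∉ (here e)  = T≢U e
    ∉∷ T≢U T∉ (there i) = T∉ i

    Classified : Set
    Classified = ∃[ P ] P ∈ pieces × Fits S P

    core : ∀ {P} → P ∈ corePieces → Fits S P → Classified
    core P∈ fits = _ , Memₚ.∈-++⁺ˡ P∈ , fits

    D-piece : ∀ {P} t → P ∈ D-pieces t → Fits S P → Classified
    D-piece t P∈ fits =
      _ , Memₚ.∈-++⁺ʳ corePieces (Memₚ.∈-concatMap⁺ D-pieces (Any.map (λ { refl → P∈ }) (Memₚ.∈-allFin t))) , fits

    classify-D : ∀ {t x} → In (D t) x → Classified
    classify-D {t} {x} x∈D = by-base (in? B (β (suc t))) (in? C o)
      where
      open MeetsD x∈D
      rest : ∀ q y → In q y → q ≢ D t → (q , y) ∈ (B , β (suc t)) ∷ (C , o) ∷ []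
      rest A     y i _ = ⊥-elim (A-empty y i)
      rest B     y i _ with B-special y i
      ... | refl = here refl
      rest C     y i _ with C-special y i
      ... | refl = there (here refl)
      rest (D s) y i s≢t = ⊥-elim (s≢t (cong (λ r → D r) (D-only s y i)))
      by-base : Dec (In B (β (suc t))) → Dec (In C o) → Classified
      by-base (yes b) (yes c) = D-piece t (there (there (there (here refl))))
        (∉∷ (λ e → full⇒¬B (full-section e) b) ∉[] , b ∷ c ∷ [] , rest)
      by-base (yes b) (no ¬c) = D-piece t (there (here refl))
        (∉∷ (λ e → full⇒¬B (full-section e) b) (∉∷ (nonempty-section x∈D) ∉[]) , b ∷ [] , rest′)
        where
        rest′ : ∀ q y → In q y → q ≢ D t → (q , y) ∈ (B , β (suc t)) ∷ []
        rest′ q y i q≢ with rest q y i q≢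
        ... | here e            = here e
        ... | there (here refl) = ⊥-elim (¬c i)
      by-base (no ¬b) (yes c) = D-piece t (there (there (here refl)))
        (∉∷ (λ e → full⇒¬C (full-section e) c) (∉∷ (nonempty-section x∈D) ∉[]) , c ∷ [] , rest′)
        where
        rest′ : ∀ q y → In q y → q ≢ D t → (q , y) ∈ (C , o) ∷ []
        rest′ q y i q≢ with rest q y i q≢
        ... | here refl = ⊥-elim (¬b i)
        ... | there c∈  = c∈
      by-base (no ¬b) (no ¬c) = D-piece t (here refl)
        (∉∷ (nonempty-section x∈D) ∉[] , [] , rest′)
        where
        rest′ : ∀ q y → In q y → q ≢ D t → (q , y) ∈ []
        rest′ q y i q≢ with rest q y i q≢
        ... | here refl         = ⊥-elim (¬b i)
        ... | there (here refl) = ⊥-elim (¬c i)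

    -- Sets avoiding every `D t`

    module AvoidsD (no-D : ∀ t x → ¬ In (D t) x) where

      Empty : Part → Set
      Empty p = ∀ x → ¬ In p x

      fits-A∷C : (∀ x → ¬ In B x) → In C o → (∀ z → In C z → z ≡ o) → section S A ≢ ∁ ⁅ o ⁆ → Classified
      fits-A∷C ¬B c c-only ≢∁ = core (there (here refl))
        (∉∷ (A-not-full ∘ full-section) (∉∷ ≢∁ ∉[]) , c ∷ [] ,
         λ { A     y i A≢A → ⊥-elim (A≢A refl)
           ; B     y i _   → ⊥-elim (¬B y i)
           ; C     y i _   → here (cong (C ,_) (c-only y i))
           ; (D t) y i _   → ⊥-elim (no-D t y i) })

      fits-B∷A : (∀ z → ¬ In C z) → In A o → (∀ x → In A x → x ≡ o) →
        (∀ j → section S B ≢ ∁ ⁅ β j ⁆) → Classified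
      fits-B∷A ¬C a a-only ≢∁ = core (there (there (there (here refl))))
        (∉∷ (B-not-full ∘ full-section)
            (λ i → case Memₚ.∈-map⁻ (λ j → ∁ ⁅ β j ⁆) i of λ { (j , _ , e) → ≢∁ j e }) ,
         a ∷ [] ,
         λ { A     y i _   → here (cong (A ,_) (a-only y i))
           ; B     y i B≢B → ⊥-elim (B≢B refl)
           ; C     y i _   → ⊥-elim (¬C y i)
           ; (D t) y i _   → ⊥-elim (no-D t y i) })

      fits-C∷B : (∀ x → ¬ In A x) → In B o → (∀ y → In B y → y ≡ o) → section S C ≢ ∁ ⁅ o ⁆ → Classified
      fits-C∷B ¬A b b-only ≢∁ = core (there (there (there (there (there (here refl))))))
        (∉∷ (C-not-full ∘ full-section) (∉∷ ≢∁ ∉[]) , b ∷ [] ,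
         λ { A     y i _   → ⊥-elim (¬A y i)
           ; B     y i _   → here (cong (B ,_) (b-only y i))
           ; C     y i C≢C → ⊥-elim (C≢C refl)
           ; (D t) y i _   → ⊥-elim (no-D t y i) })

      empty-≢∁ : ∀ {p j} → Empty p → section S p ≢ ∁ ⁅ β j ⁆
      empty-≢∁ {j = j} ¬p e = ¬p ν (cosingleton-section e ν (ν-generic j ∘ sym))

      -- The set consisting of `o` in A alone is counted in the piece of B with base `(A , o)`, with
      -- T = `⊥`. In the same way `o` in B goes to a piece of C, and `o` in C to a piece of A.
      classify-A : Empty B → Empty C → Classified
      classify-A ¬B ¬C with section S A ≟ˢ ⁅ o ⁆
      ... | yes e = let a , a-only = singleton-section e in fits-B∷A ¬C a a-only (λ j → empty-≢∁ ¬B)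
      ... | no ≢o = core (here refl)
        (∉∷ (A-not-full ∘ full-section) (∉∷ ≢o ∉[]) , [] ,
         λ { A     y i A≢A → ⊥-elim (A≢A refl)
           ; B     y i _   → ⊥-elim (¬B y i)
           ; C     y i _   → ⊥-elim (¬C y i)
           ; (D t) y i _   → ⊥-elim (no-D t y i) })

      classify-B : ∀ {y} → Empty A → In B y → Empty C → Classified
      classify-B ¬A y∈ ¬C with section S B ≟ˢ ⁅ o ⁆
      ... | yes e = let b , b-only = singleton-section e in fits-C∷B ¬A b b-only (empty-≢∁ ¬C)
      ... | no ≢o = core (there (there (here refl)))
        (∉∷ (B-not-full ∘ full-section) (∉∷ ≢o (∉∷ (nonempty-section y∈) ∉[])) , [] ,
         λ { A     y i _   → ⊥-elim (¬A y i)
           ; B     y i B≢B → ⊥-elim (B≢B refl)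
           ; C     y i _   → ⊥-elim (¬C y i)
           ; (D t) y i _   → ⊥-elim (no-D t y i) })

      classify-C : ∀ {z} → Empty A → Empty B → In C z → Classified
      classify-C ¬A ¬B z∈ with section S C ≟ˢ ⁅ o ⁆
      ... | yes e = let c , c-only = singleton-section e in fits-A∷C ¬B c c-only (empty-≢∁ ¬A)
      ... | no ≢o = core (there (there (there (there (here refl)))))
        (∉∷ (C-not-full ∘ full-section) (∉∷ ≢o (∉∷ (nonempty-section z∈) ∉[])) , [] ,
         λ { A     y i _   → ⊥-elim (¬A y i)
           ; B     y i _   → ⊥-elim (¬B y i)
           ; C     y i C≢C → ⊥-elim (C≢C refl)
           ; (D t) y i _   → ⊥-elim (no-D t y i) })

      all-o : ∀ {p x} → In p x → (∀ y → In p y → y ≡ o) → In p o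
      all-o {p} i all = subst (In p) (all _ i) i

      -- A point of C other than `o` would let C supply B. If S contains A without `o`, the slot of
      -- A goes to `B∖ ν`, which supplies that `o` and completes `B∖ o`.
      classify-AC : ∀ {x z} → In A x → Empty B → In C z → Classified
      classify-AC {x} {z} x∈ ¬B z∈ = fits-A∷C ¬B (all-o z∈ c-only) c-only λ e →
        refute (B∖ ν) (B∖ o) (C∖ o) whole
          (λ y → case y Finₚ.≟ o of λ { (yes refl) → help A refl (B→A ν-generic)
                                      ; (no y≢o)   → inj₁ (cosingleton-section e y y≢o) })
          (λ _ → own B refl (only (own A refl ν-misses-o)))
          (λ _ → own C refl (only (inj₁ (all-o z∈ c-only))))
          whole-ok
        where
        c-only : ∀ z′ → In C z′ → z′ ≡ o
        c-only z′ z′∈ = decidable-stable (z′ Finₚ.≟ o) λ z′≢o →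
          refute (A∖ x) (B∖ o) (C∖ z′) whole
            (λ _ → own A refl (only (inj₁ x∈)))
            (λ _ → own B refl (only (help C refl (C→B z′≢o))))
            (λ _ → own C refl (only (inj₁ z′∈)))
            whole-ok

      -- A point of A other than `o` would let A supply C. If only one special point of B is missing
      -- from S, the slot of B goes to a generator that supplies it: `C∖ ν` for `o`, completing
      -- `C∖ o`, or `D∖ t ν` for `β (suc t)`, supplying `o` to C.
      classify-AB : ∀ {x y} → In A x → In B y → Empty C → Classified
      classify-AB {x} {y} x∈ y∈ ¬C = fits-B∷A ¬C (all-o x∈ a-only) a-only λ
        { zero e → refute (A∖ o) (C∖ ν) (C∖ o) whole
            (λ _ → own A refl (only (inj₁ (all-o x∈ a-only))))
            (λ y → case y Finₚ.≟ o of λ { (yes refl) → help B refl (C→B ν≢o)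
                                        ; (no y≢o)   → inj₁ (cosingleton-section e y y≢o) })
            (λ _ → own C refl (only (own B refl ν-misses-o)))
            whole-ok
        ; (suc t) e → refute (A∖ o) (D∖ t ν) (C∖ o) whole
            (λ _ → own A refl (only (inj₁ (all-o x∈ a-only))))
            (λ y → case y Finₚ.≟ β (suc t) of λ { (yes refl) → help B refl D→B
                                                ; (no y≢β)   → inj₁ (cosingleton-section e y y≢β) })
            (λ _ → own C refl (only (help B refl D→C)))
            whole-ok }
        where
        a-only : ∀ x′ → In A x′ → x′ ≡ o
        a-only x′ x′∈ = decidable-stable (x′ Finₚ.≟ o) λ x′≢o →
          refute (A∖ x′) (B∖ y) (C∖ o) whole
            (λ _ → own A refl (only (inj₁ x′∈)))
            (λ _ → own B refl (only (inj₁ y∈)))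
            (λ _ → own C refl (only (help A refl (A→C x′≢o))))
            whole-ok

      -- A generic point or two special points of B in S would let B supply A, so S meets B in one
      -- special point; which one decides the piece.
      classify-BC : ∀ {y z} → Empty A → In B y → In C z → Classified
      classify-BC {y} {z} ¬A y∈ z∈ with special? y
      ... | inj₂ y-generic = ⊥-elim (refute (A∖ o) (B∖ y) (C∖ z) whole
              (λ _ → own A refl (only (help B refl (B→A y-generic))))
              (λ _ → own B refl (only (inj₁ y∈)))
              (λ _ → own C refl (only (inj₁ z∈)))
              whole-ok)
      ... | inj₁ (j , refl) = by-special j y∈ b-only
        where
        b-only : ∀ y′ → In B y′ → y′ ≡ β j
        b-only y′ y′∈ with special? y′
        ... | inj₂ y′-generic = ⊥-elim (refute (A∖ o) (B∖ y′) (C∖ z) whole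
                (λ _ → own A refl (only (help B refl (B→A y′-generic))))
                (λ _ → own B refl (only (inj₁ y′∈)))
                (λ _ → own C refl (only (inj₁ z∈)))
                whole-ok)
        ... | inj₁ (j′ , refl) = cong β (decidable-stable (j′ Finₚ.≟ j) λ j′≢j →
                refute (A∖ o) (B∖∖ j′ j) (C∖ z) whole
                (λ _ → own A refl (only (help B refl (B⇒A j′≢j))))
                (λ _ → own B refl (both (inj₁ y′∈) (inj₁ y∈)))
                (λ _ → own C refl (only (inj₁ z∈)))
                whole-ok)
        by-special : ∀ j → In B (β j) → (∀ y′ → In B y′ → y′ ≡ β j) → Classified
        by-special zero b b-only = fits-C∷B ¬A b b-only λ e →
          refute (A∖ o) (B∖ o) (A∖ ν) whole
            (λ _ → own A refl (only (own C refl ν-misses-o)))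
            (λ _ → own B refl (only (inj₁ b)))
            (λ y → case y Finₚ.≟ o of λ { (yes refl) → help C refl (A→C ν≢o)
                                        ; (no y≢o)   → inj₁ (cosingleton-section e y y≢o) })
            whole-ok
        -- S meets C only in `o`, so S is just the base of this piece, with T = `⊥`.
        by-special (suc t) b b-only = D-piece t (there (there (there (here refl))))
          (∉∷ (not-full-section (no-D t ν)) ∉[] , b ∷ all-o z∈ c-only ∷ [] ,
           λ { A     y i _ → ⊥-elim (¬A y i)
             ; B     y i _ → here (cong (B ,_) (b-only y i))
             ; C     y i _ → there (here (cong (C ,_) (c-only y i)))
             ; (D t) y i _ → ⊥-elim (no-D t y i) })
          where
          c-only : ∀ z′ → In C z′ → z′ ≡ o
          c-only z′ z′∈ = decidable-stable (z′ Finₚ.≟ o) λ z′≢o →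
            refute (A∖ o) (B∖∖ zero (suc t)) (C∖ z′) whole
              (λ _ → own A refl (only (help B refl (B⇒A λ ()))))
              (λ _ → own B refl (both (help C refl (C→B z′≢o)) (inj₁ b)))
              (λ _ → own C refl (only (inj₁ z′∈)))
              whole-ok

      inhabited? : ∀ p → (∃[ x ] In p x) ⊎ Empty p
      inhabited? p with Finₚ.any? (in? p)
      ... | yes i = inj₁ i
      ... | no ¬i = inj₂ λ x x∈ → ¬i (x , x∈)

      classify-ABC : Classified
      classify-ABC with inhabited? A | inhabited? B | inhabited? C
      ... | inj₁ (x , x∈) | inj₁ (y , y∈) | inj₁ (z , z∈) = ⊥-elim (refute (A∖ x) (B∖ y) (C∖ z) whole
              (λ _ → own A refl (only (inj₁ x∈)))
              (λ _ → own B refl (only (inj₁ y∈)))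
              (λ _ → own C refl (only (inj₁ z∈)))
              whole-ok)
      ... | inj₁ (_ , x∈) | inj₁ (_ , y∈) | inj₂ ¬C       = classify-AB x∈ y∈ ¬C
      ... | inj₁ (_ , x∈) | inj₂ ¬B       | inj₁ (_ , z∈) = classify-AC x∈ ¬B z∈
      ... | inj₂ ¬A       | inj₁ (_ , y∈) | inj₁ (_ , z∈) = classify-BC ¬A y∈ z∈
      ... | inj₂ ¬A       | inj₁ (_ , y∈) | inj₂ ¬C       = classify-B ¬A y∈ ¬C
      ... | inj₂ ¬A       | inj₂ ¬B       | inj₁ (_ , z∈) = classify-C ¬A ¬B z∈
      -- This clause includes the empty set, which is counted in the piece of A with empty base.
      ... | _             | inj₂ ¬B       | inj₂ ¬C       = classify-A ¬B ¬C

    classify : Classified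
    classify with Finₚ.any? (λ t → Finₚ.any? (in? (D t)))
    ... | yes (t , x , x∈) = classify-D x∈
    ... | no ¬D = AvoidsD.classify-ABC λ t x x∈ → ¬D (t , x , x∈)

  -- Members of k-wise intersecting extensions

  bound : Family (m * (3 + w))
  bound = map ∁ (concatMap members pieces)

  -- `U` and the complements of k - 1 generators are k members of `F`; their common point is covered
  -- neither by `∁ U` nor by these generators, so `∁ U` can be classified.
  extension⊆bound : ∀ {F} → family ⊆ F → KWiseIntersecting (4 + w) F → F ⊆ bound
  extension⊆bound {F} family⊆F kw {U} U∈F =
    let P , P∈ , fits = Classification.classify (∁ U) uncovered
    in subst (_∈ bound) (∁-involutive U) (Memₚ.∈-map⁺ ∁ (Memₚ.∈-concatMap⁺ members
         (Any.map (λ { refl → ∈-members P fits }) P∈)))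
    where
    ∁-involutive : ∀ {n} (V : Subset n) → ∁ (∁ V) ≡ V
    ∁-involutive V = trans (sym (Vecₚ.map-∘ not not V)) (trans (Vecₚ.map-cong not-involutive V) (Vecₚ.map-id V))
    uncovered : (σ : Part → Gen) → ¬ (∀ q x → (q , x) ∈ᴾ ∁ U ⊎ ∃[ p ] Covers (σ p) q x)
    uncovered σ cov = let i , i∈ = kw G (λ ()) short ⊆F in
      escape (point i) (subst (Sub._∈ ⋂ G) (sym (combine-point i)) i∈)
      where
      G = U ∷ map (complement ∘ σ) (allFin (3 + w))
      short : length G ≤ 4 + w
      short = ℕₚ.≤-reflexive (cong suc (trans (Listₚ.length-map (complement ∘ σ) (allFin (3 + w)))
                                              (Listₚ.length-tabulate {n = 3 + w} (λ p → p))))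
      ⊆F : G ⊆ F
      ⊆F (here refl) = U∈F
      ⊆F (there i) with Memₚ.∈-map⁻ (complement ∘ σ) i
      ... | p , _ , refl = family⊆F (Memₚ.∈-map⁺ complement (∈-gens (σ p)))
      escape : ∀ y → ¬ y ∈ᴾ ⋂ G
      escape (q , x) y∈ with cov q x
      ... | inj₁ x∉U     = Subₚ.x∈∁p⇒x∉p x∉U (∈-⋂⁻ G y∈ (here refl))
      ... | inj₂ (p , c) = ∈-complement⁻ (∈-⋂⁻ G y∈ (there (Memₚ.∈-map⁺ (complement ∘ σ) (Memₚ.∈-allFin p)))) c

  -- Counting

  waste : List Piece → ℕ
  waste Ps = sum (map (length ∘ excluded) Ps)

  -- The waste is added on the left instead of subtracted on the right, which avoids truncated
  -- subtraction.
  length-concatMap-members : ∀ {Ps} → All (Unique ∘ excluded) Ps →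
    length (concatMap members Ps) + waste Ps ≤ length Ps * 2 ^ m
  length-concatMap-members [] = z≤n
  length-concatMap-members {(p , X , E) ∷ Ps} (u ∷ us) = begin
    length (members (p , X , E) ++ concatMap members Ps) + (length E + waste Ps)
      ≡⟨ cong (_+ _) (Listₚ.length-++ (members (p , X , E))) ⟩
    length (members (p , X , E)) + length (concatMap members Ps) + (length E + waste Ps)
      ≡⟨ interchange (length (members (p , X , E))) _ _ _ ⟩
    (length (members (p , X , E)) + length E) + (length (concatMap members Ps) + waste Ps)
      ≤⟨ ℕₚ.+-mono-≤ (length-members p X u) (length-concatMap-members us) ⟩
    2 ^ m + length Ps * 2 ^ m ∎
    where
    open ℕₚ.≤-Reasoning
    interchange = CommSemigroupₚ.interchange ℕₚ.+-commutativeSemigroup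

  ⊤≢⊥ : _≢_ {A = Subset m} ⊤ ⊥
  ⊤≢⊥ e = Subₚ.∉⊥ (subst (o Sub.∈_) e Subₚ.∈⊤)

  ⊤≢⁅o⁆ : ⊤ ≢ ⁅ o ⁆
  ⊤≢⁅o⁆ e = ν≢o (Subₚ.x∈⁅y⁆⇒x≡y o (subst (ν Sub.∈_) e Subₚ.∈⊤))

  ⁅o⁆≢⊥ : ⁅ o ⁆ ≢ ⊥
  ⁅o⁆≢⊥ e = Subₚ.∉⊥ (subst (o Sub.∈_) e (Subₚ.x∈⁅x⁆ o))

  ⊤≢∁⁅⁆ : ∀ {x : Fin m} → ⊤ ≢ ∁ ⁅ x ⁆
  ⊤≢∁⁅⁆ {x} e = Subₚ.x∈p⇒x∉∁p (Subₚ.x∈⁅x⁆ x) (subst (x Sub.∈_) e Subₚ.∈⊤)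

  ∁⁅⁆-injective : ∀ {x y : Fin m} → ∁ ⁅ x ⁆ ≡ ∁ ⁅ y ⁆ → x ≡ y
  ∁⁅⁆-injective {x} {y} e = decidable-stable (x Finₚ.≟ y) λ x≢y →
    Subₚ.x∈p⇒x∉∁p (Subₚ.x∈⁅x⁆ x)
      (subst (x Sub.∈_) (sym e) (Subₚ.x∉p⇒x∈∁p (Subₚ.x≢y⇒x∉⁅y⁆ x≢y)))

  core-unique : All (Unique ∘ excluded) corePieces
  core-unique =
    ((⊤≢⁅o⁆ ∷ []) ∷ [] ∷ []) ∷
    ((⊤≢∁⁅⁆ ∷ []) ∷ [] ∷ []) ∷
    ((⊤≢⁅o⁆ ∷ ⊤≢⊥ ∷ []) ∷ (⁅o⁆≢⊥ ∷ []) ∷ [] ∷ []) ∷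
    (Allₚ.map⁺ (All.universal (λ _ → ⊤≢∁⁅⁆) (allFin (suc w))) ∷
      Uniqueₚ.map⁺ (β-injective ∘ ∁⁅⁆-injective) (Uniqueₚ.allFin⁺ (suc w))) ∷
    ((⊤≢⁅o⁆ ∷ ⊤≢⊥ ∷ []) ∷ (⁅o⁆≢⊥ ∷ []) ∷ [] ∷ []) ∷
    ((⊤≢∁⁅⁆ ∷ []) ∷ [] ∷ []) ∷ []

  D-unique : ∀ t → All (Unique ∘ excluded) (D-pieces t)
  D-unique t =
    ([] ∷ []) ∷
    ((⊤≢⊥ ∷ []) ∷ [] ∷ []) ∷
    ((⊤≢⊥ ∷ []) ∷ [] ∷ []) ∷
    ([] ∷ []) ∷ []

  pieces-unique : All (Unique ∘ excluded) pieces
  pieces-unique = Allₚ.++⁺ core-unique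
    (Allₚ.concat⁺ (Allₚ.map⁺ (All.universal D-unique (allFin w))))

  length-D-pieces : ∀ ts → length (concatMap D-pieces ts) ≡ length ts * 4
  length-D-pieces []       = refl
  length-D-pieces (t ∷ ts) = cong (λ l → 4 + l) (length-D-pieces ts)

  waste-D-pieces : ∀ ts → waste (concatMap D-pieces ts) ≡ length ts * 6
  waste-D-pieces []       = refl
  waste-D-pieces (t ∷ ts) = cong (λ l → 6 + l) (waste-D-pieces ts)

  length-allFin : ∀ n → length (allFin n) ≡ n
  length-allFin n = Listₚ.length-tabulate {n = n} (λ p → p)

  length-pieces : length pieces ≡ 6 + w * 4
  length-pieces = cong (λ l → 6 + l) (trans (length-D-pieces (allFin w)) (cong (_* 4) (length-allFin w)))

  waste-pieces : waste pieces ≡ 14 + w * 7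
  waste-pieces = begin
    waste pieces
      ≡⟨ cong₂ (λ j d → 2 + (2 + (3 + (1 + (1 + j) + (3 + (2 + d))))))
           (trans (Listₚ.length-map (λ j → ∁ ⁅ β j ⁆) (tabulate suc)) (Listₚ.length-tabulate {n = w} suc))
           (trans (waste-D-pieces (allFin w)) (cong (_* 6) (length-allFin w))) ⟩
    2 + (2 + (3 + (1 + (1 + w) + (3 + (2 + w * 6)))))
      ≡⟨ count w ⟩
    14 + w * 7 ∎
    where
    open ≡-Reasoning
    count : ∀ v → 2 + (2 + (3 + (1 + (1 + v) + (3 + (2 + v * 6))))) ≡ 14 + v * 7
    count = solve-∀

  length-bound : length bound + (14 + w * 7) ≤ (6 + w * 4) * 2 ^ m
  length-bound = begin
    length bound + (14 + w * 7)
      ≡⟨ cong₂ _+_ (Listₚ.length-map ∁ (concatMap members pieces)) (sym waste-pieces) ⟩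
    length (concatMap members pieces) + waste pieces
      ≤⟨ length-concatMap-members pieces-unique ⟩
    length pieces * 2 ^ m
      ≡⟨ cong (_* 2 ^ m) length-pieces ⟩
    (6 + w * 4) * 2 ^ m ∎
    where open ℕₚ.≤-Reasoning

-- Choice of the special points, and the bound over the integers

↑ˡ≢↑ʳ : ∀ {m n} (i : Fin m) (j : Fin n) → i ↑ˡ n ≢ m ↑ʳ j
↑ˡ≢↑ʳ {m} {n} i j e
  with trans (sym (Finₚ.splitAt-↑ˡ m i n)) (trans (cong (splitAt m) e) (Finₚ.splitAt-↑ʳ m n j))
... | ()

minimumSize-bound : ∀ w m → 2 + w ≤ m →
  ∃[ l ] IsMinimumSize (4 + w) (m * (3 + w)) l × l + (14 + w * 7) ≤ (6 + w * 4) * 2 ^ m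
minimumSize-bound w m 2+w≤m with ℕₚ.m≤n⇒∃[o]m+o≡n 2+w≤m
... | r , eq with trans (ℕₚ.+-suc (suc w) r) eq
...   | refl =
  let l , isMin , l≤ = minimumSize≤ family bound family-intersecting extension⊆bound
  in l , isMin , ℕₚ.≤-trans (ℕₚ.+-monoˡ-≤ (14 + w * 7) l≤) length-bound
  where
  -- The first 1 + w points of a part are special and the next is `ν`; hence the condition that m is
  -- at least 2 + w.
  open Construction {suc w + suc r} {w} (_↑ˡ suc r) (Finₚ.↑ˡ-injective (suc r) _ _)
                    (suc w ↑ʳ zero) (λ j → ↑ˡ≢↑ʳ j zero)

-- With k = 4 + w, 4k - 10 is 6 + 4w and 7(k - 2) is 14 + 7w; the subtraction is carried out over
-- the integers.
integer-bound : ∀ l w P → l + (14 + w * 7) ≤ (6 + w * 4) * P →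
  + l ℤ.≤ (+ 4 ℤ.* + (4 + w) ℤ.- + 10) ℤ.* + P ℤ.- + 7 ℤ.* (+ (4 + w) ℤ.- + 2)
integer-bound l w P h = begin
  + l
    ≡⟨ cancel (+ l) (+ (14 + w * 7)) ⟩
  + (l + (14 + w * 7)) ℤ.- + (14 + w * 7)
    ≤⟨ ℤₚ.+-monoˡ-≤ (ℤ.- + (14 + w * 7)) (ℤ.+≤+ h) ⟩
  + ((6 + w * 4) * P) ℤ.- + (14 + w * 7)
    ≡⟨ cong₂ ℤ._-_ (trans (ℤₚ.pos-* (6 + w * 4) P) (cong (λ x → (+ 6 ℤ.+ x) ℤ.* + P) (ℤₚ.pos-* w 4)))
                   (cong (λ x → + 14 ℤ.+ x) (ℤₚ.pos-* w 7)) ⟩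
  (+ 6 ℤ.+ + w ℤ.* + 4) ℤ.* + P ℤ.- (+ 14 ℤ.+ + w ℤ.* + 7)
    ≡⟨ expand (+ w) (+ P) ⟩
  (+ 4 ℤ.* + (4 + w) ℤ.- + 10) ℤ.* + P ℤ.- + 7 ℤ.* (+ (4 + w) ℤ.- + 2) ∎
  where
  open ℤₚ.≤-Reasoning
  cancel : ∀ i j → i ≡ (i ℤ.+ j) ℤ.- j
  cancel = ℤ-Solver.solve-∀
  expand : ∀ i p → (+ 6 ℤ.+ i ℤ.* + 4) ℤ.* p ℤ.- (+ 14 ℤ.+ i ℤ.* + 7) ≡
    (+ 4 ℤ.* (+ 4 ℤ.+ i) ℤ.- + 10) ℤ.* p ℤ.- + 7 ℤ.* ((+ 4 ℤ.+ i) ℤ.- + 2)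
  expand = ℤ-Solver.solve-∀

theorem1 : (k n : ℕ) → 4 ≤ k → (k ∸ 1) * (k ∸ 2) ≤ n → (d : k ∸ 1 ∣ n) →
    ∃[ m ] IsMinimumSize k n m ×
    + m ℤ.≤ (+ 4 ℤ.* + k ℤ.- + 10) ℤ.* + (2 ^ quotient d) ℤ.- + 7 ℤ.* (+ k ℤ.- + 2)
theorem1 (suc (suc (suc (suc w)))) n (s≤s (s≤s (s≤s (s≤s _)))) large (divides q refl) =
  -- Cancelling k - 1 = 3 + w in the lower bound on n leaves k - 2 = 2 + w as a lower bound on `q`.
  let l , isMin , l≤ = minimumSize-bound w q (ℕₚ.*-cancelˡ-≤ (3 + w) (ℕₚ.≤-trans large (ℕₚ.≤-reflexive (ℕₚ.*-comm q (3 + w)))))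
  in l , isMin , integer-bound l w (2 ^ q) l≤
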